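{- If $\Gamma\vdash_{\mathsf{\Lambda2}^{\mathsf{Poly}}}t:A$, then there exists a term $t^{\downarrow}$ such that $\Gamma\vdash_{\mathsf{\Lambda2_{at}}}t^{\downarrow}:A$ and $t\simeq_\varepsilon t^{\downarrow}$.
   Context: $\mathsf{\Lambda2}$ is System F in Church style (types from variables, $\Rightarrow$, $\forall$; terms $x,\lambda x.t,tu,\Lambda X.t,tB$). $\langle C_i\rangle_i\Rightarrow B$ means $C_1\Rightarrow\dots\Rightarrow C_n\Rightarrow B$ and $t\langle u_i\rangle_i$ means $tu_1\dots u_n$. **Fragments.** A *polynomial type* (in $X$) is a type $P[X]=\big\langle\langle A_{jk}\rangle_j\Rightarrow X\big\rangle_k\Rightarrow X$ with $X$ occurring only positively in the $A_{jk}$; it is *constant* if $X$ does not occur in any $A_{jk}$. $\mathsf{\Lambda2}^{\mathsf{Poly}}$ is the fragment of $\mathsf{\Lambda2}$ in which all universal types are of the form $\forall X.P[X]$ for some constant polynomial type $P[X]$. $\mathsf{\Lambda2_{at}}$ is the fragment of $\mathsf{\Lambda2}$ in which all type instantiations are atomic, i.e. type applications $tB$ are allowed only for $B$ a type variable. **$\varepsilon$-theory.** An occurrence of $X$ is positive/negative if it lies to the left of an even/odd number of arrows. If $X$ occurs only positively in $A$ and $v[x]$ satisfies $\Gamma,x:E\vdash v:F$, $\Phi_A(v)[x]$ denotes the functorial action, with $\Gamma,x:A[E/X]\vdash\Phi_A(v)[x]:A[F/X]$; if $X$ occurs only negatively, $\Gamma,x:A[F/X]\vdash\Phi_A(v)[x]:A[E/X]$.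 Explicitly $\Phi_X(v)=v$, $\Phi_A(v)=x$ if $A$ is a variable other than $X$, $\Phi_{C\Rightarrow D}(v)[x]=\lambda y.\Phi_D(v)[x(\Phi_C(v)[y])]$, $\Phi_{\forall Y.C}(v)[x]=\Lambda Y.\Phi_C(v)[xY]$. The $\varepsilon$-theory is the smallest congruence $\simeq_\varepsilon$ on typed terms containing $\beta\eta$ and closed under: ($\varepsilon^+$) for a type $\forall X.\langle\forall\vec Y_k.\langle A_{jk}\rangle_j\Rightarrow X\rangle_k\Rightarrow B$ with $X$ only positive in the $A_{jk}$ and $B$: if $t$ has this type in $\Gamma$, $e_k:\forall\vec Y_k.\langle A_{jk}[E/X]\rangle_j\Rightarrow E$, $f_k:\forall\vec Y_k.\langle A_{jk}[F/X]\rangle_j\Rightarrow F$, $\Gamma,x:E\vdash v[x]:F$, and for each $k$, $v[e_k\vec Y_k\langle z_j\rangle_j]\simeq f_k\vec Y_k\langle\Phi_{A_{jk}}(v)[z_j]\rangle_j:F$ (for variables $z_j:A_{jk}[E/X]$), then $\Phi_B(v)[tE\langle e_k\rangle_k]\simeq tF\langle f_k\rangle_k:B[F/X]$; ($\varepsilon^-$) for a type $\forall X.\langle\forall\vec Y_j.X\Rightarrow A_j\rangle_j\Rightarrow B$ with $X$ only positive in the $A_j$ and only negative in $B$: if $t$ has this type in $\Gamma$, $e_j:\forall\vec Y_j.E\Rightarrow A_j[E/X]$, $f_j:\forall\vec Y_j.F\Rightarrow A_j[F/X]$, $\Gamma,x:E\vdash v[x]:F$, and for each $j$, $\Phi_{A_j}(v)[e_j\vec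 Y_jx]\simeq f_j\vec Y_jv[x]:A_j[F/X]$ (for $x:E$), then $\Phi_B(v)[tF\langle f_j\rangle_j]\simeq tE\langle e_j\rangle_j:B[E/X]$. -}

module Defs where

open import Data.Bool.Base using (if_then_else_)
open import Data.Fin.Base using (Fin; zero; suc; _↑ˡ_; _↑ʳ_)
open import Data.Fin.Properties using (_≟_)
open import Data.Fin.Substitution using (Sub; Lift; TermSubst)
open import Data.Nat.Base using (ℕ; zero; suc; _+_)
open import Data.Product.Base using (Σ-syntax; ∃; _×_; _,_; proj₂)
open import Data.Sign.Base using (Sign; opposite) renaming (+ to pos; - to neg)
open import Data.Unit.Base using (⊤)
open import Data.Vec.Base as Vec using (Vec; []; _∷_; _++_; lookup; tabulate)
open import Data.Vec.Relation.Unary.All as VecAll using ()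
open import Relation.Nullary using (¬_; does)

private
  variable
    n n′ m m′ K : ℕ

-- Types over n type variables, as de Bruijn indices.

infixr 7 _⇒_ _⇒⋆_

data Type (n : ℕ) : Set where
  var : Fin n → Type n
  _⇒_ : Type n → Type n → Type n
  ∀′  : Type (suc n) → Type n

module TypeApp {T : ℕ → Set} (l : Lift T Type) where
  open Lift l hiding (var)

  infixl 8 _/_

  _/_ : Type n → Sub T n n′ → Type n′
  var x   / ρ = lift (lookup ρ x)
  (A ⇒ B) / ρ = (A / ρ) ⇒ (B / ρ)
  ∀′ A    / ρ = ∀′ (A / ρ ↑)

typeSubst : TermSubst Type
typeSubst = record { var = var; app = TypeApp._/_ }

open TermSubst typeSubst public using (_/_; _↑; _↑⋆_; wk; wk⋆; sub)

-- ⟨Aᵢ⟩ᵢ ⇒ B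

_⇒⋆_ : Vec (Type n) K → Type n → Type n
As ⇒⋆ B = Vec.foldr _ _⇒_ B As

-- ∀Y⃗. A for k variables Y⃗, the innermost being variable 0 of A.

∀⋆ : ∀ k → Type (k + n) → Type n
∀⋆ zero    A = A
∀⋆ (suc k) A = ∀⋆ k (∀′ A)

-- The sign of an occurrence is pos iff it lies to the left of an even
-- number of arrows.

data Occurs {n : ℕ} : Sign → Fin n → Type n → Set where
  here  : ∀ {x} → Occurs pos x (var x)
  left  : ∀ {s x A B} → Occurs (opposite s) x A → Occurs s x (A ⇒ B)
  right : ∀ {s x A B} → Occurs s x B → Occurs s x (A ⇒ B)
  under : ∀ {s x A} → Occurs s (suc x) A → Occurs s x (∀′ A)

infix 4 _∉_

_∉_ : Fin n → Type n → Set
x ∉ A = ∀ s → ¬ Occurs s x A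

OnlyPositive : Fin n → Type n → Set
OnlyPositive x A = ¬ Occurs neg x A

OnlyNegative : Fin n → Type n → Set
OnlyNegative x A = ¬ Occurs pos x A

-- Church-style terms with n type variables and m term variables.

infixl 9 _·_ _∙_ _·⋆_

data Term (n : ℕ) : ℕ → Set where
  var : Fin m → Term n m
  ƛ   : Type n → Term n (suc m) → Term n m
  _·_ : Term n m → Term n m → Term n m
  Λ   : Term (suc n) m → Term n m
  _∙_ : Term n m → Type n → Term n m

infixl 8 _/ᵀ_

_/ᵀ_ : Term n m → Sub Type n n′ → Term n′ m
var x   /ᵀ σ = var x
ƛ A t   /ᵀ σ = ƛ (A / σ) (t /ᵀ σ)
(t · u) /ᵀ σ = (t /ᵀ σ) · (u /ᵀ σ)
Λ t     /ᵀ σ = Λ (t /ᵀ σ ↑)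
(t ∙ B) /ᵀ σ = (t /ᵀ σ) ∙ (B / σ)

extʳ : (Fin m → Fin m′) → Fin (suc m) → Fin (suc m′)
extʳ ρ zero    = zero
extʳ ρ (suc x) = suc (ρ x)

ren : (Fin m → Fin m′) → Term n m → Term n m′
ren ρ (var x) = var (ρ x)
ren ρ (ƛ A t) = ƛ A (ren (extʳ ρ) t)
ren ρ (t · u) = ren ρ t · ren ρ u
ren ρ (Λ t)   = Λ (ren ρ t)
ren ρ (t ∙ B) = ren ρ t ∙ B

ext : (Fin m → Term n m′) → Fin (suc m) → Term n (suc m′)
ext σ zero    = var zero
ext σ (suc x) = ren suc (σ x)

subst : (Fin m → Term n m′) → Term n m → Term n m′
subst σ (var x) = σ x
subst σ (ƛ A t) = ƛ A (subst (ext σ) t)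
subst σ (t · u) = subst σ t · subst σ u
subst σ (Λ t)   = Λ (subst (λ x → σ x /ᵀ wk) t)
subst σ (t ∙ B) = subst σ t ∙ B

infix 10 _[_]

_[_] : Term n (suc m) → Term n m → Term n m
_[_] {n} {m} t u = subst σ t
  where
  σ : Fin (suc m) → Term n m
  σ zero    = u
  σ (suc x) = var x

-- t⟨uᵢ⟩ᵢ

_·⋆_ : Term n m → Vec (Term n m) K → Term n m
t ·⋆ us = Vec.foldl _ _·_ t us

-- t Y⃗ over a context extended with k type variables Y⃗, applied in the
-- order in which ∀⋆ k binds them.

_∙vars_ : Term n m → ∀ k → Term (k + n) m
t ∙vars zero  = t
t ∙vars suc k = ((t ∙vars k) /ᵀ wk) ∙ var zero

Ctx : ℕ → ℕ → Set
Ctx n m = Vec (Type n) m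

infixl 8 _/ᶜ_

_/ᶜ_ : Ctx n m → Sub Type n n′ → Ctx n′ m
Γ /ᶜ σ = Vec.map (_/ σ) Γ

infix 4 _⊢_∶_

data _⊢_∶_ {n m : ℕ} (Γ : Ctx n m) : Term n m → Type n → Set where
  ⊢var : ∀ x → Γ ⊢ var x ∶ lookup Γ x
  ⊢ƛ   : ∀ {A B t} → A ∷ Γ ⊢ t ∶ B → Γ ⊢ ƛ A t ∶ A ⇒ B
  ⊢·   : ∀ {A B t u} → Γ ⊢ t ∶ A ⇒ B → Γ ⊢ u ∶ A → Γ ⊢ t · u ∶ B
  ⊢Λ   : ∀ {A t} → Γ /ᶜ wk ⊢ t ∶ A → Γ ⊢ Λ t ∶ ∀′ A
  ⊢∙   : ∀ {A t} → Γ ⊢ t ∶ ∀′ A → ∀ B → Γ ⊢ t ∙ B ∶ A / sub B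

-- ⟨⟨Aⱼₖ⟩ⱼ ⇒ X⟩ₖ ⇒ X, where X is variable 0.

polynomial : Vec (∃ (Vec (Type (suc n)))) K → Type (suc n)
polynomial Ass = Vec.map (λ (_ , As) → As ⇒⋆ var zero) Ass ⇒⋆ var zero

-- Non-occurrence of X in the Aⱼₖ subsumes the positivity required of an
-- arbitrary polynomial type.

data ConstantPolynomial {n : ℕ} : Type (suc n) → Set where
  constant : (Ass : Vec (∃ (Vec (Type (suc n)))) K) →
             (∀ k j → zero ∉ lookup (proj₂ (lookup Ass k)) j) →
             ConstantPolynomial (polynomial Ass)

-- All universal types occurring in a type (also inside the Aⱼₖ) are of
-- the form ∀X.P[X] with P[X] constant polynomial.

data PolyType {n : ℕ} : Type n → Set where
  var : ∀ x → PolyType (var x)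
  _⇒_ : ∀ {A B} → PolyType A → PolyType B → PolyType (A ⇒ B)
  ∀′  : ∀ {P} → ConstantPolynomial P → PolyType P → PolyType (∀′ P)

-- All types of the judgements in a derivation, and all type arguments,
-- satisfy P. A λ-annotation is covered by the context of the premise.

AllTypes : (∀ {n} → Type n → Set) →
           {Γ : Ctx n m} {t : Term n m} {A : Type n} → Γ ⊢ t ∶ A → Set
AllTypes P {Γ} {t} {A} d = VecAll.All P Γ × P A × premises d
  where
  premises : ∀ {t A} → Γ ⊢ t ∶ A → Set
  premises (⊢var x) = ⊤
  premises (⊢ƛ d)   = AllTypes P d
  premises (⊢· d e) = AllTypes P d × AllTypes P e
  premises (⊢Λ d)   = AllTypes P d
  premises (⊢∙ d B) = AllTypes P d × P B

infix 4 _⊢Poly_∶_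

_⊢Poly_∶_ : Ctx n m → Term n m → Type n → Set
Γ ⊢Poly t ∶ A = Σ[ d ∈ Γ ⊢ t ∶ A ] AllTypes PolyType d

-- Type application is permitted only to type variables.

data AtomicInstantiations {n m : ℕ} : Term n m → Set where
  var : ∀ x → AtomicInstantiations (var x)
  ƛ   : ∀ {A t} → AtomicInstantiations t → AtomicInstantiations (ƛ A t)
  _·_ : ∀ {t u} → AtomicInstantiations t → AtomicInstantiations u →
        AtomicInstantiations (t · u)
  Λ   : ∀ {t} → AtomicInstantiations t → AtomicInstantiations (Λ t)
  _∙_ : ∀ {t} → AtomicInstantiations t → ∀ x → AtomicInstantiations (t ∙ var x)

infix 4 _⊢at_∶_

_⊢at_∶_ : Ctx n m → Term n m → Type n → Set
Γ ⊢at t ∶ A = Γ ⊢ t ∶ A × AtomicInstantiations t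

-- Φ s k E F A v u is Φ_A(v)[u]. The variable X of A is k ↑ʳ zero, the k
-- type variables below it being those bound around A. In v, variable 0 is
-- the hole, of type E, and v has type F. For s = pos (X only positive in A)
-- u has type A[E/X] and the result A[F/X]; for s = neg (X only negative)
-- these are exchanged. The case s = neg and A = X is irrelevant: X then
-- occurs positively in A.

target : Sign → Type n → Type n → Type n
target pos E F = F
target neg E F = E

Φ : Sign → ∀ k (E F : Type n) → Type (k + suc n) →
    Term (k + n) (suc m) → Term (k + n) m → Term (k + n) m
Φ s k E F (var y) v u = if does (y ≟ k ↑ʳ zero) then v [ u ] else u
Φ s k E F (C ⇒ D) v u =
  ƛ (C / sub (target s E F) ↑⋆ k)
    (Φ s k E F D v′ (ren suc u · Φ (opposite s) k E F C v′ (var zero)))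
  where v′ = ren (extʳ suc) v
Φ s k E F (∀′ C) v u =
  Λ (Φ s (suc k) E F C (v /ᵀ wk) ((u /ᵀ wk) ∙ var zero))

-- ∀Y⃗.⟨Aⱼ⟩ⱼ ⇒ X, in scope of X (variable 0). The Aⱼ are in scope of X
-- and Y⃗, so that X is variable ys ↑ʳ zero of Aⱼ.

record Clause⁺ (n : ℕ) : Set where
  field
    ys    : ℕ
    arity : ℕ
    args  : Vec (Type (ys + suc n)) arity

  X : Fin (ys + suc n)
  X = ys ↑ʳ zero

  type : Type (suc n)
  type = ∀⋆ ys (args ⇒⋆ var X)

-- ∀Y⃗.X ⇒ A

record Clause⁻ (n : ℕ) : Set where
  field
    ys  : ℕ
    arg : Type (ys + suc n)

  X : Fin (ys + suc n)
  X = ys ↑ʳ zero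

  type : Type (suc n)
  type = ∀⋆ ys (var X ⇒ arg)

-- The context Γ, Y⃗, ⟨zⱼ : Aⱼ[E/X]⟩ⱼ and, over it, the two sides of
-- v[e Y⃗⟨zⱼ⟩ⱼ] ≃ f Y⃗⟨Φ_Aⱼ(v)[zⱼ]⟩ⱼ.

module Premise⁺ (c : Clause⁺ n) (Γ : Ctx n m) (E F : Type n)
                (v : Term n (suc m)) (e f : Term n m) where
  open Clause⁺ c

  ctx : Ctx (ys + n) (arity + m)
  ctx = Vec.map (_/ sub E ↑⋆ ys) args ++ (Γ /ᶜ wk⋆ ys)

  z : Fin arity → Term (ys + n) (arity + m)
  z j = var (j ↑ˡ m)

  v′ : Term (ys + n) (suc (arity + m))
  v′ = ren (extʳ (arity ↑ʳ_)) (v /ᵀ wk⋆ ys)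

  lhs rhs : Term (ys + n) (arity + m)
  lhs = v′ [ ren (arity ↑ʳ_) (e ∙vars ys) ·⋆ tabulate z ]
  rhs = ren (arity ↑ʳ_) (f ∙vars ys)
        ·⋆ tabulate (λ j → Φ pos ys E F (lookup args j) v′ (z j))

-- The context Γ, Y⃗, x : E and, over it, the two sides of
-- Φ_A(v)[e Y⃗ x] ≃ f Y⃗ v[x].

module Premise⁻ (c : Clause⁻ n) (Γ : Ctx n m) (E F : Type n)
                (v : Term n (suc m)) (e f : Term n m) where
  open Clause⁻ c

  ctx : Ctx (ys + n) (suc m)
  ctx = (E ∷ Γ) /ᶜ wk⋆ ys

  v[x] : Term (ys + n) (suc m)
  v[x] = v /ᵀ wk⋆ ys

  lhs rhs : Term (ys + n) (suc m)
  lhs = Φ pos ys E F arg (ren (extʳ suc) v[x])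
          (ren suc (e ∙vars ys) · var zero)
  rhs = ren suc (f ∙vars ys) · v[x]

-- The least typed congruence containing βη and closed under ε⁺ and ε⁻.
-- Substitutivity is not a rule: it follows from congruence and β.

infix 4 _⊢_≃ε_∶_

data _⊢_≃ε_∶_ {n m : ℕ} (Γ : Ctx n m) :
              Term n m → Term n m → Type n → Set where

  ≃refl  : ∀ {t A} → Γ ⊢ t ∶ A → Γ ⊢ t ≃ε t ∶ A
  ≃sym   : ∀ {t u A} → Γ ⊢ t ≃ε u ∶ A → Γ ⊢ u ≃ε t ∶ A
  ≃trans : ∀ {t u w A} → Γ ⊢ t ≃ε u ∶ A → Γ ⊢ u ≃ε w ∶ A → Γ ⊢ t ≃ε w ∶ A

  ≃ƛ : ∀ {A B t u} → A ∷ Γ ⊢ t ≃ε u ∶ B → Γ ⊢ ƛ A t ≃ε ƛ A u ∶ A ⇒ B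
  ≃· : ∀ {A B t t′ u u′} → Γ ⊢ t ≃ε t′ ∶ A ⇒ B → Γ ⊢ u ≃ε u′ ∶ A →
       Γ ⊢ t · u ≃ε t′ · u′ ∶ B
  ≃Λ : ∀ {A t u} → Γ /ᶜ wk ⊢ t ≃ε u ∶ A → Γ ⊢ Λ t ≃ε Λ u ∶ ∀′ A
  ≃∙ : ∀ {A t u} → Γ ⊢ t ≃ε u ∶ ∀′ A → ∀ B →
       Γ ⊢ t ∙ B ≃ε u ∙ B ∶ A / sub B

  β⇒ : ∀ {A B t u} → A ∷ Γ ⊢ t ∶ B → Γ ⊢ u ∶ A →
       Γ ⊢ ƛ A t · u ≃ε t [ u ] ∶ B
  η⇒ : ∀ {A B t} → Γ ⊢ t ∶ A ⇒ B →
       Γ ⊢ t ≃ε ƛ A (ren suc t · var zero) ∶ A ⇒ B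
  β∀ : ∀ {A t} → Γ /ᶜ wk ⊢ t ∶ A → ∀ B →
       Γ ⊢ Λ t ∙ B ≃ε t /ᵀ sub B ∶ A / sub B
  η∀ : ∀ {A t} → Γ ⊢ t ∶ ∀′ A →
       Γ ⊢ t ≃ε Λ ((t /ᵀ wk) ∙ var zero) ∶ ∀′ A

  ε⁺ : (cs : Vec (Clause⁺ n) K) (B : Type (suc n)) →
       let open Clause⁺ in
       (∀ k j → OnlyPositive (X (lookup cs k)) (lookup (args (lookup cs k)) j)) →
       OnlyPositive zero B →
       ∀ {E F t v} {e f : Vec (Term n m) K} →
       Γ ⊢ t ∶ ∀′ (Vec.map type cs ⇒⋆ B) →
       (∀ k → Γ ⊢ lookup e k ∶ type (lookup cs k) / sub E) →
       (∀ k → Γ ⊢ lookup f k ∶ type (lookup cs k) / sub F) →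
       E ∷ Γ ⊢ v ∶ F →
       (∀ k → let open Premise⁺ (lookup cs k) Γ E F v (lookup e k) (lookup f k)
              in ctx ⊢ lhs ≃ε rhs ∶ F / wk⋆ (ys (lookup cs k))) →
       Γ ⊢ Φ pos 0 E F B v (t ∙ E ·⋆ e) ≃ε t ∙ F ·⋆ f ∶ B / sub F

  ε⁻ : (cs : Vec (Clause⁻ n) K) (B : Type (suc n)) →
       let open Clause⁻ in
       (∀ j → OnlyPositive (X (lookup cs j)) (arg (lookup cs j))) →
       OnlyNegative zero B →
       ∀ {E F t v} {e f : Vec (Term n m) K} →
       Γ ⊢ t ∶ ∀′ (Vec.map type cs ⇒⋆ B) →
       (∀ j → Γ ⊢ lookup e j ∶ type (lookup cs j) / sub E) →
       (∀ j → Γ ⊢ lookup f j ∶ type (lookup cs j) / sub F) →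
       E ∷ Γ ⊢ v ∶ F →
       (∀ j → let open Premise⁻ (lookup cs j) Γ E F v (lookup e j) (lookup f j)
              in ctx ⊢ lhs ≃ε rhs ∶
                 arg (lookup cs j) / sub F ↑⋆ ys (lookup cs j)) →
       Γ ⊢ Φ neg 0 E F B v (t ∙ F ·⋆ f) ≃ε t ∙ E ·⋆ e ∶ B / sub E

{-# OPTIONS --safe #-}
module Submission where

-- Let t : ∀X.P[X] with P[X] = ⟨⟨Aⱼₖ⟩ⱼ ⇒ X⟩ₖ ⇒ X constant. For any g : E ⇒ F,
-- ε⁺ yields g (t E ⟨eₖ⟩ₖ) ≃ t F ⟨λa⃗. g (eₖ a⃗)⟩ₖ, because Φ_Aⱼₖ is the identity up
-- to η when X is not in Aⱼₖ. Taking for g the eliminators f ↦ f c and f ↦ f Y,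
-- the arguments of t (C ⇒ D) ⟨eₖ⟩ₖ c and t (∀Y.C) ⟨eₖ⟩ₖ Y can be pushed into the
-- eₖ, which reduces instantiation at C ⇒ D to D and at ∀Y.C to C, hence by
-- η-expansion any instantiation to atomic ones.

open import Defs
open import Data.Empty using (⊥-elim)
open import Data.Fin.Base using (Fin; zero; suc; _↑ˡ_; _↑ʳ_; lift)
open import Data.Fin.Properties using (_≟_; suc-injective)
open import Data.Fin.Substitution using (Sub; Subs; Lift; TermSubst)
open import Data.Fin.Substitution.Lemmas using (TermLemmas)
open import Data.Nat.Base using (ℕ; zero; suc; _+_)
open import Data.Product.Base using (Σ; ∃; ∃-syntax; _×_; _,_; proj₁; proj₂)
open import Data.Sign.Base using (opposite) renaming (+ to pos; - to neg)
open import Data.Vec.Base as Vec using (Vec; []; _∷_; _++_; lookup; tabulate; map)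
open import Data.Vec.Properties
  using (lookup-map; map-∘; map-cong; map-id; lookup∘tabulate; lookup-++ˡ; lookup-++ʳ)
open import Function.Base using (_∘_; id)
open import Relation.Binary.Construct.Closure.ReflexiveTransitive using (ε; _◅_; _▻_)
open import Relation.Binary.PropositionalEquality as ≡
  using (_≡_; _≢_; refl; sym; trans; cong; cong₂)
open import Relation.Nullary using (yes; no)

private
  variable
    n n′ m m′ m″ K : ℕ

-- Substitution lemmas for types.

open TermSubst typeSubst using (_⊙_; weaken) renaming (id to idˢ)

module _ {T : ℕ → Set} {l : Lift T Type} where
  open TermSubst.Lifted typeSubst l using (_↑✶_; _/✶_)

  ⇒-/✶-↑✶ : ∀ k {A B : Type (k + n)} (ρs : Subs T n n′) →
            (A ⇒ B) /✶ ρs ↑✶ k ≡ (A /✶ ρs ↑✶ k) ⇒ (B /✶ ρs ↑✶ k)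
  ⇒-/✶-↑✶ k ε        = refl
  ⇒-/✶-↑✶ k (ρ ◅ ρs) = cong (λ A → TypeApp._/_ l A _) (⇒-/✶-↑✶ k ρs)

  ∀-/✶-↑✶ : ∀ k {A : Type (suc (k + n))} (ρs : Subs T n n′) →
            ∀′ A /✶ ρs ↑✶ k ≡ ∀′ (A /✶ ρs ↑✶ suc k)
  ∀-/✶-↑✶ k ε        = refl
  ∀-/✶-↑✶ k (ρ ◅ ρs) = cong (λ A → TypeApp._/_ l A _) (∀-/✶-↑✶ k ρs)

module _ {T₁ T₂ : ℕ → Set} {l₁ : Lift T₁ Type} {l₂ : Lift T₂ Type} where
  open TermSubst.Lifted typeSubst l₁ using ()
    renaming (_↑✶_ to _↑✶₁_; _/✶_ to _/✶₁_)
  open TermSubst.Lifted typeSubst l₂ using ()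
    renaming (_↑✶_ to _↑✶₂_; _/✶_ to _/✶₂_)

  -- This is the one property from which `TermLemmas` derives all the substitution laws used below.
  -- Agreement on variables is assumed at every depth `k`, so the induction on the type can pass
  -- under `∀′`.
  /✶-↑✶ : ∀ (ρs₁ : Subs T₁ n n′) (ρs₂ : Subs T₂ n n′) →
          (∀ k x → var x /✶₁ ρs₁ ↑✶₁ k ≡ var x /✶₂ ρs₂ ↑✶₂ k) →
          ∀ k A → A /✶₁ ρs₁ ↑✶₁ k ≡ A /✶₂ ρs₂ ↑✶₂ k
  /✶-↑✶ ρs₁ ρs₂ eq k (var x) = eq k x
  /✶-↑✶ ρs₁ ρs₂ eq k (A ⇒ B) =
    trans (⇒-/✶-↑✶ k ρs₁)
      (trans (cong₂ _⇒_ (/✶-↑✶ ρs₁ ρs₂ eq k A) (/✶-↑✶ ρs₁ ρs₂ eq k B))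
        (sym (⇒-/✶-↑✶ k ρs₂)))
  /✶-↑✶ ρs₁ ρs₂ eq k (∀′ A) =
    trans (∀-/✶-↑✶ k ρs₁)
      (trans (cong ∀′ (/✶-↑✶ ρs₁ ρs₂ eq (suc k) A)) (sym (∀-/✶-↑✶ k ρs₂)))

typeLemmas : TermLemmas Type
typeLemmas = record { termSubst = typeSubst ; app-var = refl ; /✶-↑✶ = /✶-↑✶ }

open TermLemmas typeLemmas
  using (id-vanishes; /-⊙; wk-commutes; sub-commutes; wk-sub-vanishes;
         map-weaken-⊙-sub; lookup-id; lookup-wk; lookup-wk-↑⋆)

/ᶜ-id : (Γ : Ctx n m) → Γ /ᶜ idˢ ≡ Γ
/ᶜ-id Γ = trans (map-cong id-vanishes Γ) (map-id Γ)

/ᶜ-wk-commutes : (Γ : Ctx n m) {σ : Sub Type n n′} → Γ /ᶜ wk /ᶜ σ ↑ ≡ Γ /ᶜ σ /ᶜ wk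
/ᶜ-wk-commutes Γ =
  trans (sym (map-∘ _ _ Γ)) (trans (map-cong (λ A → sym (wk-commutes A)) Γ) (map-∘ _ _ Γ))

-- Gives `(t /ᵀ wk) ∙ var zero`, the body of an η-expansion at `∀′ A`, the type `A` itself.
/-wk↑-sub : (A : Type (suc n)) → A / wk ↑ / sub (var zero) ≡ A
/-wk↑-sub A = begin
  A / wk ↑ / sub (var zero)   ≡⟨ /-⊙ A ⟨
  A / (wk ↑ ⊙ sub (var zero)) ≡⟨ cong (λ ρ → A / (var zero ∷ ρ)) map-weaken-⊙-sub ⟩
  -- `var zero ∷ wk`, obtained by cancelling `sub (var zero)` in the tail, is `idˢ` by definition.
  A / idˢ                     ≡⟨ id-vanishes A ⟩
  A                           ∎
  where
  open ≡.≡-Reasoning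

⇒⋆-/ : (As : Vec (Type n) K) {B : Type n} (σ : Sub Type n n′) →
       (As ⇒⋆ B) / σ ≡ map (_/ σ) As ⇒⋆ (B / σ)
⇒⋆-/ []       σ = refl
⇒⋆-/ (A ∷ As) σ = cong (_ ⇒_) (⇒⋆-/ As σ)

-- Fresh type variables

∉-⇒ˡ : ∀ {x : Fin n} {A B} → x ∉ A ⇒ B → x ∉ A
∉-⇒ˡ x∉ pos o = x∉ neg (left o)
∉-⇒ˡ x∉ neg o = x∉ pos (left o)

∉-⇒ʳ : ∀ {x : Fin n} {A B} → x ∉ A ⇒ B → x ∉ B
∉-⇒ʳ x∉ s o = x∉ s (right o)

∉-∀ : ∀ {x : Fin n} {A} → x ∉ ∀′ A → suc x ∉ A
∉-∀ x∉ s o = x∉ s (under o)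

AgreeOff : Fin n → Sub Type n n′ → Sub Type n n′ → Set
AgreeOff x ρ ρ′ = ∀ y → y ≢ x → lookup ρ y ≡ lookup ρ′ y

AgreeOff-↑ : ∀ {x : Fin n} {ρ ρ′ : Sub Type n n′} →
             AgreeOff x ρ ρ′ → AgreeOff (suc x) (ρ ↑) (ρ′ ↑)
AgreeOff-↑ agree zero    _  = refl
AgreeOff-↑ {ρ = ρ} {ρ′} agree (suc y) y≢x =
  trans (lookup-map y weaken ρ)
    (trans (cong weaken (agree y (y≢x ∘ cong suc))) (sym (lookup-map y weaken ρ′)))

AgreeOff-sub-↑⋆ : ∀ k {E F : Type n} → AgreeOff (k ↑ʳ zero) (sub E ↑⋆ k) (sub F ↑⋆ k)
AgreeOff-sub-↑⋆ zero    zero    y≢0 = ⊥-elim (y≢0 refl)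
AgreeOff-sub-↑⋆ zero    (suc y) _   = refl
AgreeOff-sub-↑⋆ (suc k)             = AgreeOff-↑ (AgreeOff-sub-↑⋆ k)

-- Applied to two pairs that differ only at X: the instantiations at `E` and at `F`, and the
-- identity against `sub E ⊙ wk`.
/-agree : ∀ {x : Fin n} {ρ ρ′ : Sub Type n n′} A →
          AgreeOff x ρ ρ′ → x ∉ A → A / ρ ≡ A / ρ′
/-agree (var y) agree x∉ = agree y λ { refl → x∉ pos here }
/-agree (A ⇒ B) agree x∉ =
  cong₂ _⇒_ (/-agree A agree (∉-⇒ˡ x∉)) (/-agree B agree (∉-⇒ʳ x∉))
/-agree (∀′ A)  agree x∉ = cong ∀′ (/-agree A (AgreeOff-↑ agree) (∉-∀ x∉))

-- `idˢ` and `sub E ⊙ wk` differ only at variable 0, so any `E` exhibits `A` as a weakening.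
strengthen : ∀ {E : Type n} A → zero ∉ A → A ≡ A / sub E / wk
strengthen {E = E} A 0∉ = begin
  A                ≡⟨ id-vanishes A ⟨
  A / idˢ          ≡⟨ /-agree A agree 0∉ ⟩
  A / (sub E ⊙ wk) ≡⟨ /-⊙ A ⟩
  A / sub E / wk   ∎
  where
  open ≡.≡-Reasoning
  agree : AgreeOff zero idˢ (sub E ⊙ wk)
  agree zero    0≢0 = ⊥-elim (0≢0 refl)
  agree (suc y) _   = begin
    lookup idˢ (suc y)   ≡⟨ lookup-id (suc y) ⟩
    var (suc y)          ≡⟨ lookup-wk y ⟨
    var y / wk           ≡⟨ cong (_/ wk) (lookup-id y) ⟨
    lookup idˢ y / wk    ≡⟨ lookup-map y (_/ wk) idˢ ⟨
    lookup (idˢ ⊙ wk) y  ∎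

lift-suc-≢ : ∀ k (y : Fin (k + n)) → lift k suc y ≢ k ↑ʳ zero
lift-suc-≢ zero    y       ()
lift-suc-≢ (suc k) zero    ()
lift-suc-≢ (suc k) (suc y) eq = lift-suc-≢ k y (suc-injective eq)

∉-wk-↑⋆ : ∀ k (A : Type (k + n)) → k ↑ʳ zero ∉ A / wk ↑⋆ k
∉-wk-↑⋆ k (var y) s o rewrite lookup-wk-↑⋆ k y = lemma o refl
  where
  -- The variable `x` is kept general so that matching on `here` need not unify `k ↑ʳ zero` with
  -- `lift k suc y`.
  lemma : ∀ {x s} → Occurs s x (var (lift k suc y)) → x ≢ k ↑ʳ zero
  lemma here = lift-suc-≢ k y
∉-wk-↑⋆ k (A ⇒ B) s (left o)  = ∉-wk-↑⋆ k A (opposite s) o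
∉-wk-↑⋆ k (A ⇒ B) s (right o) = ∉-wk-↑⋆ k B s o
∉-wk-↑⋆ k (∀′ A)  s (under o) = ∉-wk-↑⋆ (suc k) A s o

-- Renaming and substitution in terms

/ᵀ-id : (t : Term n m) → t /ᵀ idˢ ≡ t
/ᵀ-id (var x) = refl
/ᵀ-id (ƛ A t) = cong₂ ƛ (id-vanishes A) (/ᵀ-id t)
/ᵀ-id (t · u) = cong₂ _·_ (/ᵀ-id t) (/ᵀ-id u)
/ᵀ-id (Λ t)   = cong Λ (/ᵀ-id t)
/ᵀ-id (t ∙ B) = cong₂ _∙_ (/ᵀ-id t) (id-vanishes B)

ren-/ᵀ : ∀ {ρ : Fin m → Fin m′} {σ : Sub Type n n′} (t : Term n m) →
         ren ρ (t /ᵀ σ) ≡ ren ρ t /ᵀ σ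
ren-/ᵀ (var x) = refl
ren-/ᵀ (ƛ A t) = cong (ƛ _) (ren-/ᵀ t)
ren-/ᵀ (t · u) = cong₂ _·_ (ren-/ᵀ t) (ren-/ᵀ u)
ren-/ᵀ (Λ t)   = cong Λ (ren-/ᵀ t)
ren-/ᵀ (t ∙ B) = cong (_∙ _) (ren-/ᵀ t)

extʳ-id : ∀ {ρ : Fin m → Fin m} → (∀ x → ρ x ≡ x) → ∀ x → extʳ ρ x ≡ x
extʳ-id ρ≗id zero    = refl
extʳ-id ρ≗id (suc x) = cong suc (ρ≗id x)

ren-id : ∀ {ρ : Fin m → Fin m} → (∀ x → ρ x ≡ x) → (t : Term n m) → ren ρ t ≡ t
ren-id ρ≗id (var x) = cong var (ρ≗id x)
ren-id ρ≗id (ƛ A t) = cong (ƛ A) (ren-id (extʳ-id ρ≗id) t)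
ren-id ρ≗id (t · u) = cong₂ _·_ (ren-id ρ≗id t) (ren-id ρ≗id u)
ren-id ρ≗id (Λ t)   = cong Λ (ren-id ρ≗id t)
ren-id ρ≗id (t ∙ B) = cong (_∙ B) (ren-id ρ≗id t)

-- The composite is specified pointwise, here and in the fusion lemmas for `subst`: without function
-- extensionality, extending a composite under a binder cannot be identified with composing the
-- extensions.
ren-ren : ∀ {ρ : Fin m′ → Fin m″} {ρ′ : Fin m → Fin m′} {ρ″ : Fin m → Fin m″} →
          (∀ x → ρ (ρ′ x) ≡ ρ″ x) → (t : Term n m) → ren ρ (ren ρ′ t) ≡ ren ρ″ t
ren-ren eq (var x) = cong var (eq x)
ren-ren {ρ = ρ} {ρ′} {ρ″} eq (ƛ A t) = cong (ƛ A) (ren-ren eq↑ t)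
  where
  eq↑ : ∀ x → extʳ ρ (extʳ ρ′ x) ≡ extʳ ρ″ x
  eq↑ zero    = refl
  eq↑ (suc x) = cong suc (eq x)
ren-ren eq (t · u) = cong₂ _·_ (ren-ren eq t) (ren-ren eq u)
ren-ren eq (Λ t)   = cong Λ (ren-ren eq t)
ren-ren eq (t ∙ B) = cong (_∙ B) (ren-ren eq t)

ren-suc : ∀ {ρ : Fin m → Fin m′} (t : Term n m) →
          ren (extʳ ρ) (ren suc t) ≡ ren suc (ren ρ t)
ren-suc t = trans (ren-ren (λ _ → refl) t) (sym (ren-ren (λ _ → refl) t))

subst-ren : ∀ {σ : Fin m′ → Term n m″} {ρ : Fin m → Fin m′} {τ : Fin m → Term n m″} →
            (∀ x → σ (ρ x) ≡ τ x) → (t : Term n m) → subst σ (ren ρ t) ≡ subst τ t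
subst-ren eq (var x) = eq x
subst-ren {σ = σ} {ρ} {τ} eq (ƛ A t) = cong (ƛ A) (subst-ren eq↑ t)
  where
  eq↑ : ∀ x → ext σ (extʳ ρ x) ≡ ext τ x
  eq↑ zero    = refl
  eq↑ (suc x) = cong (ren suc) (eq x)
subst-ren eq (t · u) = cong₂ _·_ (subst-ren eq t) (subst-ren eq u)
subst-ren eq (Λ t)   = cong Λ (subst-ren (λ x → cong (_/ᵀ wk) (eq x)) t)
subst-ren eq (t ∙ B) = cong (_∙ B) (subst-ren eq t)

ren-subst : ∀ {ρ : Fin m′ → Fin m″} {σ : Fin m → Term n m′} {τ : Fin m → Term n m″} →
            (∀ x → ren ρ (σ x) ≡ τ x) → (t : Term n m) → ren ρ (subst σ t) ≡ subst τ t
ren-subst eq (var x) = eq x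
ren-subst {ρ = ρ} {σ} {τ} eq (ƛ A t) = cong (ƛ A) (ren-subst eq↑ t)
  where
  eq↑ : ∀ x → ren (extʳ ρ) (ext σ x) ≡ ext τ x
  eq↑ zero    = refl
  eq↑ (suc x) = trans (ren-suc (σ x)) (cong (ren suc) (eq x))
ren-subst eq (t · u) = cong₂ _·_ (ren-subst eq t) (ren-subst eq u)
ren-subst {σ = σ} eq (Λ t) =
  cong Λ (ren-subst (λ x → trans (ren-/ᵀ (σ x)) (cong (_/ᵀ wk) (eq x))) t)
ren-subst eq (t ∙ B) = cong (_∙ B) (ren-subst eq t)

subst-suc : ∀ {σ : Fin m → Term n m′} (t : Term n m) →
            subst (ext σ) (ren suc t) ≡ ren suc (subst σ t)
subst-suc t = trans (subst-ren (λ _ → refl) t) (sym (ren-subst (λ _ → refl) t))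

subst-var : ∀ {σ : Fin m → Term n m} → (∀ x → σ x ≡ var x) → (t : Term n m) →
            subst σ t ≡ t
subst-var eq (var x) = eq x
subst-var {σ = σ} eq (ƛ A t) = cong (ƛ A) (subst-var eq↑ t)
  where
  eq↑ : ∀ x → ext σ x ≡ var x
  eq↑ zero    = refl
  eq↑ (suc x) = cong (ren suc) (eq x)
subst-var eq (t · u) = cong₂ _·_ (subst-var eq t) (subst-var eq u)
subst-var eq (Λ t)   = cong Λ (subst-var (λ x → cong (_/ᵀ wk) (eq x)) t)
subst-var eq (t ∙ B) = cong (_∙ B) (subst-var eq t)

ren-suc-[] : (t u : Term n m) → ren suc t [ u ] ≡ t
ren-suc-[] t u = trans (subst-ren (λ _ → refl) t) (subst-var (λ _ → refl) t)

ren-·⋆ : ∀ {ρ : Fin m → Fin m′} {t : Term n m} (us : Vec (Term n m) K) →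
         ren ρ (t ·⋆ us) ≡ ren ρ t ·⋆ map (ren ρ) us
ren-·⋆ []       = refl
ren-·⋆ (u ∷ us) = ren-·⋆ us

/ᵀ-·⋆ : ∀ {σ : Sub Type n n′} {t : Term n m} (us : Vec (Term n m) K) →
        (t ·⋆ us) /ᵀ σ ≡ (t /ᵀ σ) ·⋆ map (_/ᵀ σ) us
/ᵀ-·⋆ []       = refl
/ᵀ-·⋆ (u ∷ us) = /ᵀ-·⋆ us

atomic-ren : ∀ {ρ : Fin m → Fin m′} {t : Term n m} →
             AtomicInstantiations t → AtomicInstantiations (ren ρ t)
atomic-ren (var x) = var _
atomic-ren (ƛ a)   = ƛ (atomic-ren a)
atomic-ren (a · b) = atomic-ren a · atomic-ren b
atomic-ren (Λ a)   = Λ (atomic-ren a)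
atomic-ren (a ∙ X) = atomic-ren a ∙ X

-- A general type substitution destroys atomicity, but weakening sends variables to variables. The
-- depth `k` counts the `Λ` already passed.
atomic-wk : ∀ k {t : Term (k + n) m} →
            AtomicInstantiations t → AtomicInstantiations (t /ᵀ wk ↑⋆ k)
atomic-wk k (var x) = var x
atomic-wk k (ƛ a)   = ƛ (atomic-wk k a)
atomic-wk k (a · b) = atomic-wk k a · atomic-wk k b
atomic-wk k (Λ a)   = Λ (atomic-wk (suc k) a)
atomic-wk k (a ∙ X) rewrite lookup-wk-↑⋆ k X = atomic-wk k a ∙ _

atomic-·⋆ : ∀ {t : Term n m} (us : Vec (Term n m) K) → AtomicInstantiations t →
            (∀ k → AtomicInstantiations (lookup us k)) → AtomicInstantiations (t ·⋆ us)
atomic-·⋆ []       a as = a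
atomic-·⋆ (u ∷ us) a as = atomic-·⋆ us (a · as zero) (as ∘ suc)

-- Typing

⊢ren : ∀ {Γ : Ctx n m} {Δ : Ctx n m′} {ρ : Fin m → Fin m′} {t A} →
       (∀ x → lookup Δ (ρ x) ≡ lookup Γ x) → Γ ⊢ t ∶ A → Δ ⊢ ren ρ t ∶ A
⊢ren {Δ = Δ} eq (⊢var x) = ≡.subst (Δ ⊢ _ ∶_) (eq x) (⊢var _)
⊢ren {Γ = Γ} {Δ} {ρ} eq (⊢ƛ {A = A} ⊢t) = ⊢ƛ (⊢ren eq↑ ⊢t)
  where
  eq↑ : ∀ x → lookup (A ∷ Δ) (extʳ ρ x) ≡ lookup (A ∷ Γ) x
  eq↑ zero    = refl
  eq↑ (suc x) = eq x
⊢ren eq (⊢· ⊢t ⊢u) = ⊢· (⊢ren eq ⊢t) (⊢ren eq ⊢u)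
⊢ren {Γ = Γ} {Δ} {ρ} eq (⊢Λ ⊢t) = ⊢Λ (⊢ren eq↑ ⊢t)
  where
  eq↑ : ∀ x → lookup (Δ /ᶜ wk) (ρ x) ≡ lookup (Γ /ᶜ wk) x
  eq↑ x = trans (lookup-map (ρ x) _ Δ) (trans (cong (_/ wk) (eq x)) (sym (lookup-map x _ Γ)))
⊢ren eq (⊢∙ ⊢t B) = ⊢∙ (⊢ren eq ⊢t) B

⊢suc : ∀ {Γ : Ctx n m} {t A B} → Γ ⊢ t ∶ A → B ∷ Γ ⊢ ren suc t ∶ A
⊢suc = ⊢ren λ _ → refl

⊢/ᵀ : ∀ {Γ : Ctx n m} {t A} (σ : Sub Type n n′) → Γ ⊢ t ∶ A → Γ /ᶜ σ ⊢ t /ᵀ σ ∶ A / σ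
⊢/ᵀ {Γ = Γ} σ (⊢var x) = ≡.subst (_ ⊢ _ ∶_) (lookup-map x _ Γ) (⊢var x)
⊢/ᵀ σ (⊢ƛ ⊢t)    = ⊢ƛ (⊢/ᵀ σ ⊢t)
⊢/ᵀ σ (⊢· ⊢t ⊢u) = ⊢· (⊢/ᵀ σ ⊢t) (⊢/ᵀ σ ⊢u)
⊢/ᵀ {Γ = Γ} σ (⊢Λ ⊢t) = ⊢Λ (≡.subst (_⊢ _ ∶ _) (/ᶜ-wk-commutes Γ) (⊢/ᵀ (σ ↑) ⊢t))
⊢/ᵀ σ (⊢∙ {A = A} ⊢t B) = ≡.subst (_ ⊢ _ ∶_) (sym (sub-commutes A)) (⊢∙ (⊢/ᵀ σ ⊢t) (B / σ))

⊢·⋆ : ∀ {Γ : Ctx n m} {t D} (Ts : Vec (Type n) K) (us : Vec (Term n m) K) →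
      Γ ⊢ t ∶ Ts ⇒⋆ D → (∀ k → Γ ⊢ lookup us k ∶ lookup Ts k) → Γ ⊢ t ·⋆ us ∶ D
⊢·⋆ []       []       ⊢t ⊢us = ⊢t
⊢·⋆ (T ∷ Ts) (u ∷ us) ⊢t ⊢us = ⊢·⋆ Ts us (⊢· ⊢t (⊢us zero)) (⊢us ∘ suc)

≃·⋆ : ∀ {Γ : Ctx n m} {t t′ D} (Ts : Vec (Type n) K) (us us′ : Vec (Term n m) K) →
      Γ ⊢ t ≃ε t′ ∶ Ts ⇒⋆ D → (∀ k → Γ ⊢ lookup us k ≃ε lookup us′ k ∶ lookup Ts k) →
      Γ ⊢ t ·⋆ us ≃ε t′ ·⋆ us′ ∶ D
≃·⋆ []       []       []         t≃ us≃ = t≃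
≃·⋆ (T ∷ Ts) (u ∷ us) (u′ ∷ us′) t≃ us≃ = ≃·⋆ Ts us us′ (≃· t≃ (us≃ zero)) (us≃ ∘ suc)

-- At a variable other than X, `Φ` returns `u`; at `⇒` and `∀′` it produces an η-expansion of `u`.
-- Hence `v` is never inserted. Typing is proved simultaneously because the η and reflexivity rules
-- ask for it, and the sign is arbitrary because it flips at the domain of an arrow.
Φ-fresh : ∀ s k {E F : Type n} A {Γ : Ctx (k + n) m} {v u} → k ↑ʳ zero ∉ A →
          Γ ⊢ u ∶ A / sub E ↑⋆ k →
          Γ ⊢ Φ s k E F A v u ∶ A / sub E ↑⋆ k ×
          Γ ⊢ Φ s k E F A v u ≃ε u ∶ A / sub E ↑⋆ k
Φ-fresh s k (var y) x∉ ⊢u with y ≟ k ↑ʳ zero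
... | yes refl = ⊥-elim (x∉ pos here)
... | no  _    = ⊢u , ≃refl ⊢u
Φ-fresh s k {E} {F} (C ⇒ D) {Γ} {v} {u} x∉ ⊢u =
  -- `Φ` annotates its λ with `C / sub (target s E F) ↑⋆ k`; since X is fresh in `C`, this equals
  -- the domain `C / sub E ↑⋆ k`.
  ≡.subst (λ A → Γ ⊢ ƛ A body ∶ CD × Γ ⊢ ƛ A body ≃ε u ∶ CD)
    (/-agree C (AgreeOff-sub-↑⋆ k) (∉-⇒ˡ x∉))
    (⊢ƛ ⊢b , ≃trans (≃ƛ (≃trans b≃ (≃· (≃refl (⊢suc ⊢u)) y≃))) (≃sym (η⇒ ⊢u)))
  where
  CD = (C ⇒ D) / sub E ↑⋆ k
  v′ = ren (extʳ suc) v
  arg = Φ (opposite s) k E F C v′ (var zero)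
  body = Φ s k E F D v′ (ren suc u · arg)
  open Σ (Φ-fresh (opposite s) k C {(C / sub E ↑⋆ k) ∷ Γ} {v′} (∉-⇒ˡ x∉) (⊢var zero))
    renaming (proj₁ to ⊢y; proj₂ to y≃)
  open Σ (Φ-fresh s k D {v = v′} (∉-⇒ʳ x∉) (⊢· (⊢suc ⊢u) ⊢y))
    renaming (proj₁ to ⊢b; proj₂ to b≃)
Φ-fresh s k (∀′ C) x∉ ⊢u =
  let ⊢b , b≃ = Φ-fresh s (suc k) C (∉-∀ x∉)
                  (≡.subst (_ ⊢ _ ∶_) (/-wk↑-sub _) (⊢∙ (⊢/ᵀ wk ⊢u) (var zero)))
  in ⊢Λ ⊢b , ≃trans (≃Λ b≃) (≃sym (η∀ ⊢u))

-- The terms λa⃗. g (e a⃗).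

postcompose : Term n m → Vec (Type n) K → Term n m → Term n m
postcompose g []       e = g · e
postcompose g (A ∷ As) e = ƛ A (postcompose (ren suc g) As (ren suc e · var zero))

⊢postcompose : ∀ {Γ : Ctx n m} {g e E F} (As : Vec (Type n) K) →
               Γ ⊢ g ∶ E ⇒ F → Γ ⊢ e ∶ As ⇒⋆ E → Γ ⊢ postcompose g As e ∶ As ⇒⋆ F
⊢postcompose []       ⊢g ⊢e = ⊢· ⊢g ⊢e
⊢postcompose (A ∷ As) ⊢g ⊢e = ⊢ƛ (⊢postcompose As (⊢suc ⊢g) (⊢· (⊢suc ⊢e) (⊢var zero)))

atomic-postcompose : ∀ {g e : Term n m} (As : Vec (Type n) K) →
                     AtomicInstantiations g → AtomicInstantiations e →
                     AtomicInstantiations (postcompose g As e)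
atomic-postcompose []       a b = a · b
atomic-postcompose (A ∷ As) a b =
  ƛ (atomic-postcompose As (atomic-ren a) (atomic-ren b · var zero))

ren-postcompose : ∀ {ρ : Fin m → Fin m′} {g e : Term n m} (As : Vec (Type n) K) →
                  ren ρ (postcompose g As e) ≡ postcompose (ren ρ g) As (ren ρ e)
ren-postcompose []       = refl
ren-postcompose {g = g} {e} (A ∷ As) = cong (ƛ A) (trans (ren-postcompose As)
  (cong₂ (λ g′ e′ → postcompose g′ As (e′ · var zero)) (ren-suc g) (ren-suc e)))

subst-postcompose : ∀ {σ : Fin m → Term n m′} {g e : Term n m} (As : Vec (Type n) K) →
                    subst σ (postcompose g As e) ≡ postcompose (subst σ g) As (subst σ e)
subst-postcompose []       = refl
subst-postcompose {g = g} {e} (A ∷ As) = cong (ƛ A) (trans (subst-postcompose As)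
  (cong₂ (λ g′ e′ → postcompose g′ As (e′ · var zero)) (subst-suc g) (subst-suc e)))

postcompose-β : ∀ {Γ : Ctx n m} {g e E F} (As : Vec (Type n) K) (us : Vec (Term n m) K) →
                Γ ⊢ g ∶ E ⇒ F → Γ ⊢ e ∶ As ⇒⋆ E →
                (∀ k → Γ ⊢ lookup us k ∶ lookup As k) →
                Γ ⊢ postcompose g As e ·⋆ us ≃ε g · (e ·⋆ us) ∶ F
postcompose-β []       []       ⊢g ⊢e ⊢us = ≃refl (⊢· ⊢g ⊢e)
postcompose-β {Γ = Γ} {g} {e} {F = F} (A ∷ As) (u ∷ us) ⊢g ⊢e ⊢us = ≃trans
  (≃·⋆ As us us
    (≡.subst (Γ ⊢ postcompose g (A ∷ As) e · u ≃ε_∶ As ⇒⋆ F) contractum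
      (β⇒ (⊢postcompose As (⊢suc ⊢g) (⊢· (⊢suc ⊢e) (⊢var zero))) (⊢us zero)))
    (λ k → ≃refl (⊢us (suc k))))
  (postcompose-β As us ⊢g (⊢· ⊢e (⊢us zero)) (⊢us ∘ suc))
  where
  contractum : postcompose (ren suc g) As (ren suc e · var zero) [ u ] ≡
               postcompose g As (e · u)
  contractum = trans (subst-postcompose As)
    (cong₂ (λ g′ e′ → postcompose g′ As (e′ · u)) (ren-suc-[] g u) (ren-suc-[] e u))

-- Constant polynomial types

-- ⟨Aⱼₖ⟩ⱼ for one k, with n excluding X: constancy is enforced by scoping.

ArgTypes : ℕ → Set
ArgTypes n = ∃ (Vec (Type n))

infixl 8 _/ᴬ_

_/ᴬ_ : ArgTypes n → Sub Type n n′ → ArgTypes n′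
(_ , As) /ᴬ σ = _ , map (_/ σ) As

branch : Type n → ArgTypes n → Type n
branch B (_ , As) = As ⇒⋆ B

branch-/ : ∀ {B : Type n} {A⃗} (σ : Sub Type n n′) →
           branch B A⃗ / σ ≡ branch (B / σ) (A⃗ /ᴬ σ)
branch-/ {A⃗ = _ , As} σ = ⇒⋆-/ As σ

-- This is P[B]: as X is not in scope of the argument types, instantiation changes only the result
-- types.
elimType : Vec (ArgTypes n) K → Type n → Type n
elimType Ass B = map (branch B) Ass ⇒⋆ B

elimType-/ : ∀ (Ass : Vec (ArgTypes n) K) {B} (σ : Sub Type n n′) →
             elimType Ass B / σ ≡ elimType (map (_/ᴬ σ) Ass) (B / σ)
elimType-/ Ass {B} σ = trans (⇒⋆-/ (map (branch B) Ass) σ)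
  (cong (_⇒⋆ _) (trans (sym (map-∘ _ _ Ass))
    (trans (map-cong (λ A⃗ → branch-/ {A⃗ = A⃗} σ) Ass) (map-∘ _ _ Ass))))

constantPolynomial : Vec (ArgTypes n) K → Type (suc n)
constantPolynomial Ass = polynomial (map (_/ᴬ wk) Ass)

map-/-strengthen : ∀ {E : Type n} (As : Vec (Type (suc n)) K) →
                   (∀ j → zero ∉ lookup As j) → As ≡ map (_/ wk) (map (_/ sub E) As)
map-/-strengthen []       fresh = refl
map-/-strengthen (A ∷ As) fresh =
  cong₂ _∷_ (strengthen A (fresh zero)) (map-/-strengthen As (fresh ∘ suc))

-- Passes from constancy as non-occurrence, as in `ConstantPolynomial`, to constancy by scoping.
map-/ᴬ-strengthen : ∀ {E : Type n} (Ass : Vec (ArgTypes (suc n)) K) →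
                    (∀ k j → zero ∉ lookup (proj₂ (lookup Ass k)) j) →
                    Ass ≡ map (_/ᴬ wk) (map (_/ᴬ sub E) Ass)
map-/ᴬ-strengthen []               fresh = refl
map-/ᴬ-strengthen ((_ , As) ∷ Ass) fresh =
  cong₂ _∷_ (cong (_ ,_) (map-/-strengthen As (fresh zero))) (map-/ᴬ-strengthen Ass (fresh ∘ suc))

map-/-wk-sub : ∀ {E : Type n} (As : Vec (Type n) K) → map (_/ sub E) (map (_/ wk) As) ≡ As
map-/-wk-sub As = trans (sym (map-∘ _ _ As)) (trans (map-cong wk-sub-vanishes As) (map-id As))

map-/ᴬ-wk-sub : ∀ {E : Type n} (Ass : Vec (ArgTypes n) K) →
                map (_/ᴬ sub E) (map (_/ᴬ wk) Ass) ≡ Ass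
map-/ᴬ-wk-sub Ass = trans (sym (map-∘ _ _ Ass))
  (trans (map-cong (λ (_ , As) → cong (_ ,_) (map-/-wk-sub As)) Ass) (map-id Ass))

map-/ᴬ-wk-↑ : ∀ (Ass : Vec (ArgTypes n) K) (σ : Sub Type n n′) →
              map (_/ᴬ σ ↑) (map (_/ᴬ wk) Ass) ≡ map (_/ᴬ wk) (map (_/ᴬ σ) Ass)
map-/ᴬ-wk-↑ Ass σ = trans (sym (map-∘ _ _ Ass))
  -- The argument types of one branch form a vector of types, so the lemma on contexts applies to
  -- them verbatim.
  (trans (map-cong (λ (_ , As) → cong (_ ,_) (/ᶜ-wk-commutes As)) Ass) (map-∘ _ _ Ass))

constantPolynomial-sub : ∀ (Ass : Vec (ArgTypes n) K) B →
                         constantPolynomial Ass / sub B ≡ elimType Ass B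
constantPolynomial-sub Ass B = trans (elimType-/ (map (_/ᴬ wk) Ass) (sub B))
  (cong (λ Bss → elimType Bss B) (map-/ᴬ-wk-sub Ass))

-- Constant polynomial types are stable under type substitution; for `σ = wk` this keeps the type of
-- the head polynomial under a `Λ`.
constantPolynomial-↑ : ∀ (Ass : Vec (ArgTypes n) K) (σ : Sub Type n n′) →
                       constantPolynomial Ass / σ ↑ ≡ constantPolynomial (map (_/ᴬ σ) Ass)
constantPolynomial-↑ Ass σ = trans (elimType-/ (map (_/ᴬ wk) Ass) (σ ↑))
  (cong (λ Bss → elimType Bss (var zero)) (map-/ᴬ-wk-↑ Ass σ))

-- The branches of a polynomial type have no quantifier prefix, hence `ys = 0`.
clause : ArgTypes n → Clause⁺ n
clause (_ , As) = record { ys = 0 ; arity = _ ; args = map (_/ wk) As }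

⊢elim : ∀ {Γ : Ctx n m} (Ass : Vec (ArgTypes n) K) {t E} es →
        Γ ⊢ t ∶ ∀′ (constantPolynomial Ass) →
        (∀ k → Γ ⊢ lookup es k ∶ branch E (lookup Ass k)) →
        Γ ⊢ t ∙ E ·⋆ es ∶ E
⊢elim {Γ = Γ} Ass {E = E} es ⊢t ⊢es = ⊢·⋆ (map (branch E) Ass) es
  (≡.subst (Γ ⊢ _ ∶_) (constantPolynomial-sub Ass E) (⊢∙ ⊢t E))
  (λ k → ≡.subst (Γ ⊢ _ ∶_) (sym (lookup-map k (branch E) Ass)) (⊢es k))

postcomposeᴬ : Term n m → ArgTypes n → Term n m → Term n m
postcomposeᴬ g (_ , As) e = postcompose g As e

postcomposes : Term n m → Vec (ArgTypes n) K → Vec (Term n m) K → Vec (Term n m) K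
postcomposes g Ass es = tabulate λ k → postcomposeᴬ g (lookup Ass k) (lookup es k)

-- Naturality of elimination, from ε⁺.

module Naturality {Γ : Ctx n m} {g : Term n m} {E F : Type n} (⊢g : Γ ⊢ g ∶ E ⇒ F) where

  v : Term n (suc m)
  v = ren suc g · var zero

  -- The clause enters through an equation because `lookup (map clause Ass) k` does not reduce for a
  -- variable `k`; matching on `refl` lets the fields of the clause compute.
  ⊢branch : ∀ {e A⃗ c} D → c ≡ clause A⃗ → Γ ⊢ e ∶ branch D A⃗ → Γ ⊢ e ∶ Clause⁺.type c / sub D
  ⊢branch {A⃗ = _ , As} D refl ⊢e = ≡.subst (Γ ⊢ _ ∶_)
    (sym (trans (⇒⋆-/ (map (_/ wk) As) (sub D)) (cong (_⇒⋆ D) (map-/-wk-sub As)))) ⊢e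

  -- The left side is g (e z⃗). The right side is the postcomposed branch applied to the `Φ` terms,
  -- which `Φ-fresh` reduces to the zⱼ; `postcompose-β` then joins the two.
  premise : ∀ {e f A⃗ c} → c ≡ clause A⃗ → f ≡ postcomposeᴬ g A⃗ e → Γ ⊢ e ∶ branch E A⃗ →
            let open Premise⁺ c Γ E F v e f in ctx ⊢ lhs ≃ε rhs ∶ F / wk⋆ (Clause⁺.ys c)
  premise {e} {A⃗ = A⃗@(a , As)} {c} refl refl ⊢e =
    ≡.subst (ctx ⊢ lhs ≃ε rhs ∶_) (sym (id-vanishes F))
      (≡.subst (ctx ⊢_≃ε rhs ∶ F) (sym lhs≡)
        (≃trans (≃sym (postcompose-β As zs ⊢g′ ⊢e′ ⊢zs))
          (≃·⋆ As zs Φzs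
            (≡.subst (ctx ⊢ postcompose g′ As e′ ≃ε_∶ As ⇒⋆ F) (sym (ren-postcompose As))
              (≃refl (⊢postcompose As ⊢g′ ⊢e′)))
            zs≃)))
    where
    open Premise⁺ c Γ E F v e (postcompose g As e)
    g′ = ren (a ↑ʳ_) g
    e′ = ren (a ↑ʳ_) e
    w = e′ ·⋆ tabulate z
    Φz = λ j → Φ pos 0 E F (lookup (map (_/ wk) As) j) v′ (z j)
    zs = tabulate z
    Φzs = tabulate Φz

    -- Although `ys` is 0, `wk⋆ 0` is the identity substitution, whose action is trivial only
    -- propositionally.
    ctx≡ : ctx ≡ As ++ Γ
    ctx≡ = cong₂ _++_ (map-/-wk-sub As) (/ᶜ-id Γ)

    ⊢shift : ∀ {t A} → Γ ⊢ t ∶ A → ctx ⊢ ren (a ↑ʳ_) t ∶ A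
    ⊢shift = ⊢ren λ x → trans (cong (λ Δ → lookup Δ (a ↑ʳ x)) ctx≡) (lookup-++ʳ As Γ x)

    ⊢g′ = ⊢shift ⊢g
    ⊢e′ = ⊢shift ⊢e

    ⊢z : ∀ j → ctx ⊢ z j ∶ lookup As j
    ⊢z j = ≡.subst (ctx ⊢ z j ∶_)
      (trans (cong (λ Δ → lookup Δ (j ↑ˡ m)) ctx≡) (lookup-++ˡ As Γ j)) (⊢var (j ↑ˡ m))

    ⊢zs : ∀ j → ctx ⊢ lookup zs j ∶ lookup As j
    ⊢zs j = ≡.subst (ctx ⊢_∶ lookup As j) (sym (lookup∘tabulate z j)) (⊢z j)

    Φz≃z : ∀ j → ctx ⊢ Φz j ≃ε z j ∶ lookup As j
    Φz≃z j rewrite lookup-map j (_/ wk) As =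
      ≡.subst (ctx ⊢ Φ pos 0 E F (lookup As j / wk) v′ (z j) ≃ε z j ∶_) (wk-sub-vanishes _)
        (proj₂ (Φ-fresh pos 0 (lookup As j / wk) (∉-wk-↑⋆ 0 (lookup As j))
          (≡.subst (ctx ⊢ z j ∶_) (sym (wk-sub-vanishes _)) (⊢z j))))

    zs≃ : ∀ j → ctx ⊢ lookup zs j ≃ε lookup Φzs j ∶ lookup As j
    zs≃ j = ≡.subst₂ (ctx ⊢_≃ε_∶ lookup As j)
      (sym (lookup∘tabulate z j)) (sym (lookup∘tabulate Φz j)) (≃sym (Φz≃z j))

    lhs≡ : lhs ≡ g′ · w
    lhs≡ = cong (_· w) (begin
      ren (extʳ (a ↑ʳ_)) (ren suc g /ᵀ idˢ) [ w ]
        ≡⟨ cong (λ t → ren (extʳ (a ↑ʳ_)) t [ w ]) (/ᵀ-id (ren suc g)) ⟩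
      ren (extʳ (a ↑ʳ_)) (ren suc g) [ w ]  ≡⟨ cong (_[ w ]) (ren-suc g) ⟩
      ren suc g′ [ w ]                      ≡⟨ ren-suc-[] g′ w ⟩
      g′                                    ∎)
      where open ≡.≡-Reasoning

  -- This is `ε⁺` with body X and v[x] = g x. At X the functorial action is substitution into `v`,
  -- so the left side becomes g applied to the elimination at `E`.
  naturality : ∀ (Ass : Vec (ArgTypes n) K) {t} es →
               Γ ⊢ t ∶ ∀′ (constantPolynomial Ass) →
               (∀ k → Γ ⊢ lookup es k ∶ branch E (lookup Ass k)) →
               Γ ⊢ g · (t ∙ E ·⋆ es) ≃ε t ∙ F ·⋆ postcomposes g Ass es ∶ F
  naturality Ass {t} es ⊢t ⊢es =
    ≡.subst (λ g′ → Γ ⊢ g′ · (t ∙ E ·⋆ es) ≃ε t ∙ F ·⋆ fs ∶ F) (ren-suc-[] g _)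
      (ε⁺ cs (var zero) positive (λ ()) {e = es} {fs}
        (≡.subst (λ Ts → Γ ⊢ t ∶ ∀′ (Ts ⇒⋆ var zero)) types ⊢t)
        (λ k → ⊢branch E (lookup-clause k) (⊢es k))
        (λ k → ⊢branch F (lookup-clause k)
          (≡.subst (Γ ⊢_∶ _) (sym (lookup-fs k)) (⊢postcompose _ ⊢g (⊢es k))))
        (⊢· (⊢suc ⊢g) (⊢var zero))
        (λ k → premise (lookup-clause k) (lookup-fs k) (⊢es k)))
    where
    cs = map clause Ass
    fs = postcomposes g Ass es

    lookup-clause : ∀ k → lookup cs k ≡ clause (lookup Ass k)
    lookup-clause k = lookup-map k clause Ass

    lookup-fs : ∀ k → lookup fs k ≡ postcomposeᴬ g (lookup Ass k) (lookup es k)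
    lookup-fs = lookup∘tabulate _

    types : map (branch (var zero)) (map (_/ᴬ wk) Ass) ≡ map Clause⁺.type cs
    types = trans (sym (map-∘ _ _ Ass)) (map-∘ _ _ Ass)

    positive : ∀ k j → OnlyPositive (Clause⁺.X (lookup cs k))
                                    (lookup (Clause⁺.args (lookup cs k)) j)
    -- `j` is bound after the rewrite because its type contains the arity of `lookup cs k`.
    positive k rewrite lookup-clause k = λ j →
      ≡.subst (OnlyPositive zero) (sym (lookup-map j _ (proj₂ (lookup Ass k))))
        (∉-wk-↑⋆ 0 (lookup (proj₂ (lookup Ass k)) j) neg)

open Naturality using (naturality)

-- Atomic forms

infix 4 _⊢at≃_∶_

_⊢at≃_∶_ : Ctx n m → Term n m → Type n → Set
Γ ⊢at≃ t ∶ A = ∃[ t↓ ] (Γ ⊢at t↓ ∶ A × Γ ⊢ t ≃ε t↓ ∶ A)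

at≃-trans : ∀ {Γ : Ctx n m} {t u A} → Γ ⊢ t ≃ε u ∶ A → Γ ⊢at≃ u ∶ A → Γ ⊢at≃ t ∶ A
at≃-trans t≃u (u↓ , at , u≃) = u↓ , at , ≃trans t≃u u≃

at≃-η⇒ : ∀ {Γ : Ctx n m} {t A B} → Γ ⊢ t ∶ A ⇒ B →
         A ∷ Γ ⊢at≃ ren suc t · var zero ∶ B → Γ ⊢at≃ t ∶ A ⇒ B
at≃-η⇒ ⊢t (u , (⊢u , a) , t≃u) = ƛ _ u , (⊢ƛ ⊢u , ƛ a) , ≃trans (η⇒ ⊢t) (≃ƛ t≃u)

at≃-η∀ : ∀ {Γ : Ctx n m} {t A} → Γ ⊢ t ∶ ∀′ A →
         Γ /ᶜ wk ⊢at≃ (t /ᵀ wk) ∙ var zero ∶ A → Γ ⊢at≃ t ∶ ∀′ A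
at≃-η∀ ⊢t (u , (⊢u , a) , t≃u) = Λ u , (⊢Λ ⊢u , Λ a) , ≃trans (η∀ ⊢t) (≃Λ t≃u)

-- Each η-expansion adds a variable to the context, so the hypothesis is stated for all renamings of
-- `t`; this lets the arguments be collected one by one.
at≃-η⇒⋆ : ∀ {Γ : Ctx n m} {t D} (Ts : Vec (Type n) K) → Γ ⊢ t ∶ Ts ⇒⋆ D →
          (∀ {m′} {Δ : Ctx n m′} {ρ : Fin m → Fin m′} →
             (∀ x → lookup Δ (ρ x) ≡ lookup Γ x) →
             ∀ us → (∀ k → Δ ⊢at lookup us k ∶ lookup Ts k) →
             Δ ⊢at≃ ren ρ t ·⋆ us ∶ D) →
          Γ ⊢at≃ t ∶ Ts ⇒⋆ D
at≃-η⇒⋆ {Γ = Γ} {t} {D} [] ⊢t h =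
  ≡.subst (Γ ⊢at≃_∶ D) (ren-id (λ _ → refl) t) (h {ρ = id} (λ _ → refl) [] λ ())
at≃-η⇒⋆ {t = t} {D} (T ∷ Ts) ⊢t h =
  at≃-η⇒ ⊢t (at≃-η⇒⋆ Ts (⊢· (⊢suc ⊢t) (⊢var zero)) λ {_} {Δ} {ρ} eq us at →
    ≡.subst (λ t′ → Δ ⊢at≃ t′ · var (ρ zero) ·⋆ us ∶ D) (sym (ren-ren (λ _ → refl) t))
      -- The freshly bound variable, as seen in `Δ`, becomes the first argument.
      (h (eq ∘ suc) (var (ρ zero) ∷ us) λ
        { zero    → ≡.subst (Δ ⊢ _ ∶_) (eq zero) (⊢var _) , var _
        ; (suc k) → at k }))

-- One descent step, from instantiation at `E` to instantiation at `F`. Postcomposing atomic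
-- branches with an atomic `g` keeps them atomic, so `h` can be the induction hypothesis at `F`.
at≃-naturality : ∀ {Γ : Ctx n m} (Ass : Vec (ArgTypes n) K) {t g u E F} es →
                 Γ ⊢ t ∶ ∀′ (constantPolynomial Ass) →
                 (∀ k → Γ ⊢at lookup es k ∶ branch E (lookup Ass k)) →
                 Γ ⊢at g ∶ E ⇒ F →
                 Γ ⊢ g · (t ∙ E ·⋆ es) ≃ε u ∶ F →
                 (∀ fs → (∀ k → Γ ⊢at lookup fs k ∶ branch F (lookup Ass k)) →
                    Γ ⊢at≃ t ∙ F ·⋆ fs ∶ F) →
                 Γ ⊢at≃ u ∶ F
at≃-naturality {Γ = Γ} Ass {g = g} {F = F} es ⊢t at (⊢g , a) g≃u h =
  at≃-trans (≃trans (≃sym g≃u) (naturality ⊢g Ass es ⊢t (proj₁ ∘ at)))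
    (h (postcomposes g Ass es) λ k →
      ≡.subst (Γ ⊢at_∶ branch F (lookup Ass k)) (sym (lookup∘tabulate _ k))
        (⊢postcompose _ ⊢g (proj₁ (at k)) ,
         atomic-postcompose (proj₂ (lookup Ass k)) a (proj₂ (at k))))

-- Induction on `B`, with `es` general because every step postcomposes the branches. The head is a
-- variable: it is atomic and remains a variable under renaming and type weakening.
at≃-elim : ∀ (B : Type n) {Γ : Ctx n m} (Ass : Vec (ArgTypes n) K) {x} es →
           Γ ⊢ var x ∶ ∀′ (constantPolynomial Ass) →
           (∀ k → Γ ⊢at lookup es k ∶ branch B (lookup Ass k)) →
           Γ ⊢at≃ var x ∙ B ·⋆ es ∶ B
at≃-elim (var Y) {Γ} Ass {x} es ⊢x at =
  _ , (⊢t , atomic-·⋆ es (var x ∙ Y) (proj₂ ∘ at)) , ≃refl ⊢t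
  where
  ⊢t = ⊢elim Ass es ⊢x (proj₁ ∘ at)
at≃-elim (C ⇒ D) {Γ} Ass {x} es ⊢x at = at≃-η⇒ ⊢t
  (at≃-naturality Ass (map (ren suc) es) (⊢suc ⊢x) at′
    -- The eliminator λf. f c, where c, index 1 below f, is the variable introduced by the
    -- η-expansion.
    (⊢ƛ (⊢· (⊢var zero) (⊢var (suc zero))) , ƛ (var zero · var (suc zero)))
    (≡.subst (λ t → C ∷ Γ ⊢ _ · t ≃ε ren suc (var x ∙ (C ⇒ D) ·⋆ es) · var zero ∶ D)
      (ren-·⋆ es)
      (β⇒ (⊢· (⊢var zero) (⊢var (suc zero))) (⊢suc ⊢t)))
    λ fs → at≃-elim D Ass fs (⊢suc ⊢x))
  where
  ⊢t = ⊢elim Ass es ⊢x (proj₁ ∘ at)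

  at′ : ∀ k → C ∷ Γ ⊢at lookup (map (ren suc) es) k ∶ branch (C ⇒ D) (lookup Ass k)
  at′ k = ≡.subst (C ∷ Γ ⊢at_∶ _) (sym (lookup-map k _ es))
    (⊢suc (proj₁ (at k)) , atomic-ren (proj₂ (at k)))
at≃-elim (∀′ C) {Γ} Ass {x} es ⊢x at = at≃-η∀ ⊢t
  (at≃-naturality Ass′ (map (_/ᵀ wk) es) ⊢x′ at′
    -- The eliminator λf. f Y, with Y the type variable introduced by the η-expansion: an atomic
    -- instantiation.
    (⊢ƛ ⊢0∙Y , ƛ (var zero ∙ zero))
    (≡.subst (λ t → Γ /ᶜ wk ⊢ _ · t ≃ε ((var x ∙ ∀′ C ·⋆ es) /ᵀ wk) ∙ var zero ∶ C)
      (/ᵀ-·⋆ es)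
      (β⇒ ⊢0∙Y (⊢/ᵀ wk ⊢t)))
    λ fs → at≃-elim C Ass′ fs ⊢x′)
  where
  ⊢t = ⊢elim Ass es ⊢x (proj₁ ∘ at)
  Ass′ = map (_/ᴬ wk) Ass

  ⊢x′ : Γ /ᶜ wk ⊢ var x ∶ ∀′ (constantPolynomial Ass′)
  ⊢x′ = ≡.subst (λ P → Γ /ᶜ wk ⊢ var x ∶ ∀′ P) (constantPolynomial-↑ Ass wk) (⊢/ᵀ wk ⊢x)

  ⊢0∙Y : ∀′ C / wk ∷ Γ /ᶜ wk ⊢ var zero ∙ var zero ∶ C
  ⊢0∙Y = ≡.subst (∀′ C / wk ∷ Γ /ᶜ wk ⊢ var zero ∙ var zero ∶_) (/-wk↑-sub C)
    (⊢∙ {A = C / wk ↑} (⊢var zero) (var zero))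

  at′ : ∀ k → Γ /ᶜ wk ⊢at lookup (map (_/ᵀ wk) es) k ∶ branch (∀′ C / wk) (lookup Ass′ k)
  at′ k = ≡.subst₂ (Γ /ᶜ wk ⊢at_∶_) (sym (lookup-map k _ es))
    (trans (branch-/ {A⃗ = lookup Ass k} wk) (cong (branch _) (sym (lookup-map k _ Ass))))
    (⊢/ᵀ wk (proj₁ (at k)) , atomic-wk 0 (proj₂ (at k)))

-- η-expanding over all branches turns the bare instantiation into the fully applied one handled by
-- `at≃-elim`.
at≃-instantiate : ∀ (B : Type n) {Γ : Ctx n m} (Ass : Vec (ArgTypes n) K) {x} →
                  Γ ⊢ var x ∶ ∀′ (constantPolynomial Ass) →
                  Γ ⊢at≃ var x ∙ B ∶ constantPolynomial Ass / sub B
at≃-instantiate B {Γ} Ass ⊢x =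
  ≡.subst (Γ ⊢at≃ _ ∶_) (sym (constantPolynomial-sub Ass B))
    (at≃-η⇒⋆ (map (branch B) Ass) (≡.subst (Γ ⊢ _ ∶_) (constantPolynomial-sub Ass B) (⊢∙ ⊢x B))
      λ {_} {Δ} eq us at → at≃-elim B Ass us (⊢ren eq ⊢x)
        (λ k → ≡.subst (Δ ⊢at lookup us k ∶_) (lookup-map k (branch B) Ass) (at k)))

-- By β, t B is (λx. x B) t, so it is enough to make x B atomic for a variable x and apply the
-- result to the atomic form of t.
at≃-∙ : ∀ {Γ : Ctx n m} {P t} → ConstantPolynomial P → Γ ⊢at≃ t ∶ ∀′ P →
        ∀ B → Γ ⊢at≃ t ∙ B ∶ P / sub B
at≃-∙ {Γ = Γ} {t = t} (constant Ass fresh) (t↓ , (⊢t↓ , a) , t≃) B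
  -- Matching on `refl` replaces `Ass` by the weakening of `Ass′`, so that P becomes
  -- `constantPolynomial Ass′`.
  with map (_/ᴬ sub B) Ass | map-/ᴬ-strengthen {E = B} Ass fresh
... | Ass′ | refl =
  let u , (⊢u , b) , x∙B≃u = at≃-instantiate B Ass′ (⊢var zero)
  in ƛ (∀′ _) u · t↓ , (⊢· (⊢ƛ ⊢u) ⊢t↓ , ƛ b · a) ,
     ≃trans (≃∙ t≃ B)
       (≃trans (≃sym (β⇒ (⊢∙ (⊢var zero) B) ⊢t↓))
         (≃· (≃ƛ x∙B≃u) (≃refl ⊢t↓)))

-- Induction on typing derivations.

theorem8p3 : ∀ {n m : ℕ} {Γ : Ctx n m} {t : Term n m} {A : Type n} →
    Γ ⊢Poly t ∶ A → ∃[ t↓ ] (Γ ⊢at t↓ ∶ A × Γ ⊢ t ≃ε t↓ ∶ A)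
theorem8p3 (⊢var x , _) = var x , (⊢var x , var x) , ≃refl (⊢var x)
theorem8p3 (⊢ƛ ⊢t , _ , _ , p) =
  let t↓ , (⊢t↓ , a) , t≃ = theorem8p3 (⊢t , p)
  in ƛ _ t↓ , (⊢ƛ ⊢t↓ , ƛ a) , ≃ƛ t≃
theorem8p3 (⊢· ⊢t ⊢u , _ , _ , p , q) =
  let t↓ , (⊢t↓ , a) , t≃ = theorem8p3 (⊢t , p)
      u↓ , (⊢u↓ , b) , u≃ = theorem8p3 (⊢u , q)
  in t↓ · u↓ , (⊢· ⊢t↓ ⊢u↓ , a · b) , ≃· t≃ u≃
theorem8p3 (⊢Λ ⊢t , _ , _ , p) =
  let t↓ , (⊢t↓ , a) , t≃ = theorem8p3 (⊢t , p)
  in Λ t↓ , (⊢Λ ⊢t↓ , Λ a) , ≃Λ t≃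
-- The subderivation concludes with the quantified type being instantiated; its `PolyType` proof
-- supplies the constancy of the body.
theorem8p3 (⊢∙ ⊢t B , _ , _ , p@(_ , ∀′ constant-P _ , _) , _) =
  at≃-∙ constant-P (theorem8p3 (⊢t , p)) B
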